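{- Let $G=(V,E)$ be a finite simple graph and $k$ a positive integer. Suppose that every vertex has degree at most $k$ and that the set of vertices of degree exactly $k$ spans no cycle in $G$ (i.e. the subgraph induced by the vertices of degree $k$ is a forest). Then there is a proper edge colouring $\phi:E\to\{1,\dots,k\}$ which is local, i.e. for every edge $e=xy$, $$\phi(e)\le \max\{d(x)+\pi(x),\; d(y)+\pi(y)\},$$ where $d(z)$ is the degree of $z$ and $\pi(z)$ is the maximum multiplicity of an edge at $z$ (so $\pi(z)=1$ for every non-isolated vertex $z$ of a simple graph).
   Context: An edge colouring is proper if no two distinct edges sharing an end-point receive the same colour. -}

module Defs where

open import Data.Nat using (ℕ; zero; suc; _+_; _≤_; _⊔_)
open import Data.Fin using (Fin; zero; suc; inject₁; fromℕ)
open import Data.Bool using (Bool; true; false; if_then_else_)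
open import Data.List using (List; map) renaming (allFin to allFinL)
open import Data.Nat.ListAction using (sum)
open import Data.Empty using (⊥)
open import Data.Product using (Σ; _×_; _,_)
open import Relation.Binary.PropositionalEquality using (_≡_; _≢_)
open import Function.Definitions using (Injective)

record SimpleGraph (n : ℕ) : Set where
  field
    adj   : Fin n → Fin n → Bool
    sym   : ∀ x y → adj x y ≡ adj y x
    loopless : ∀ x → adj x x ≡ false
open SimpleGraph public

deg : ∀ {n} → SimpleGraph n → Fin n → ℕ
deg {n} G v = sum (map (λ w → if adj G v w then 1 else 0) (allFinL n))

-- π(v) = maximum multiplicity of an edge at v (1 if v is non-isolated, 0 otherwise)
mult : ∀ {n} → SimpleGraph n → Fin n → ℕ
mult G v with deg G v
... | zero  = 0
... | suc _ = 1

record CycleIn {n} (G : SimpleGraph n) (P : Fin n → Set) : Set where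
  field
    j     : ℕ
    f     : Fin (suc (suc (suc j))) → Fin n
    inj   : Injective _≡_ _≡_ f
    step  : ∀ (i : Fin (suc (suc j))) → adj G (f (inject₁ i)) (f (suc i)) ≡ true
    close : adj G (f (fromℕ (suc (suc j)))) (f zero) ≡ true
    inP   : ∀ i → P (f i)

MaxDegreeForest : ∀ {n} → SimpleGraph n → ℕ → Set
MaxDegreeForest G k = CycleIn G (λ v → deg G v ≡ k) → ⊥

-- An edge colouring: φ x y is the colour of the edge xy (values on non-edges irrelevant).
-- It must be well defined on edges (φ x y = φ y x), use colours in {1,…,k},
-- and be proper: two distinct edges xy, xz at a common vertex get different colours.
record ProperLocalColouring {n} (G : SimpleGraph n) (k : ℕ) : Set where
  field
    φ        : Fin n → Fin n → ℕ
    symm     : ∀ x y → adj G x y ≡ true → φ x y ≡ φ y x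
    range    : ∀ x y → adj G x y ≡ true → 1 ≤ φ x y × φ x y ≤ k
    proper   : ∀ x y z → adj G x y ≡ true → adj G x z ≡ true → y ≢ z → φ x y ≢ φ x z
    local    : ∀ x y → adj G x y ≡ true →
               φ x y ≤ (deg G x + mult G x) ⊔ (deg G y + mult G y)

{-# OPTIONS --safe #-}
module Submission where

{-
Let t v = min(k, d(v) + 1). A proper colouring with φ(xy) ≤ max(t x, t y) is local and uses only
the colours 1, …, k; the vertices with d(v) = t v ("full" vertices) are those of degree k. Among
partial colourings of this kind, maximise first the number of coloured edges (size) and then the
number of pairs (v, c) such that c ≤ t v occurs at v (saturation). All changes are made of slides:
if xy is uncoloured, xz has colour c and y misses c, then c is moved from xz to xy.

Suppose xy is uncoloured, and grow a Vizing fan at x by slides, giving each new fan vertex v a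
missing colour ≤ t v; such slides never decrease the saturation. The fan stops
 * at a colour missing at x, and then one more edge gets coloured;
 * at a full vertex z, and then xz becomes the uncoloured edge and the fan is restarted at z;
   repeating this gives a non-backtracking walk in the full vertices, hence a cycle;
 * at a repeated colour β. Then swap the α/β chain from x, where α ≤ t x is missing at x. The
   saturation plus the number of the two missing colours at the ends of the uncoloured edge that
   are within the bound t of their end is invariant along the chain and starts 2 higher. If
   the bound on an edge uv forbids the next colour c, then c > t u, t v, so at most one of these
   two colours still counts and the saturation has increased. Otherwise the swap is completed as
   in Vizing's theorem and one more edge gets coloured.
-}

open import Defs
open import Data.Nat using (ℕ; zero; suc; _+_; _*_; _⊔_; _⊓_; _≤_; _<_; _≤?_; z≤n; s≤s)
  renaming (_≟_ to _≟ℕ_)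
open import Data.Nat.Properties hiding (_≟_; _≤?_)
open import Data.Nat.ListAction using () renaming (sum to sumList)
open import Data.Nat.Solver using (module +-*-Solver)
open import Data.Fin using (Fin; zero; suc; toℕ; inject₁; fromℕ) renaming (_≟_ to _≟F_)
open import Data.Fin.Properties using (any?; all?; ¬∀⟶∃¬; toℕ<n; toℕ-injective; injective⇒≤)
open import Data.Bool using (Bool; true; false; if_then_else_)
import Data.Bool.Properties as Bool
open import Data.List using (List; []; _∷_; map; filter; length; lookup; allFin)
import Data.List.Membership.DecPropositional as DecMembership
open import Data.List.Membership.Propositional using (_∈_; _∉_)
open import Data.List.Membership.Propositional.Properties using (∈-filter⁺; ∈-allFin; ∈-lookup)
import Data.List.Membership.Setoid.Properties as Membership
open import Data.List.Relation.Unary.Any using (here; there; index)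
open import Data.List.Relation.Unary.All using () renaming (lookup to All-lookup)
open import Data.List.Relation.Unary.All.Properties using (¬Any⇒All¬)
open import Data.List.Relation.Unary.AllPairs using ([]; _∷_)
open import Data.List.Relation.Unary.Unique.Propositional using (Unique)
open import Data.Product using (∃; _×_; _,_; proj₁; proj₂)
open import Data.Sum using (_⊎_; inj₁; inj₂; [_,_]′)
open import Function using (_∘_; case_of_)
open import Function.Definitions using (Injective)
open import Relation.Nullary using (¬_; Dec; yes; no; contradiction)
open import Relation.Nullary.Decidable using (_×-dec_; _⊎-dec_)
open import Relation.Binary.PropositionalEquality
  using (_≡_; _≢_; refl; trans; cong; cong₂; subst; setoid; ≢-sym; module ≡-Reasoning) renaming (sym to ≡-sym)
open import Algebra.Properties.Monoid.Sum +-0-monoid using (sum; sum-cong-≗)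

-- Finite sums, duplicate-free lists and degree counting.

sum-update : ∀ {m} (f g : Fin m → ℕ) i → (∀ j → j ≢ i → g j ≡ f j) →
  sum g + f i ≡ sum f + g i
sum-update f g zero eq
  rewrite sum-cong-≗ {x = g ∘ suc} {y = f ∘ suc} (λ j → eq (suc j) λ ()) =
  solve 3 (λ a b s → (a :+ s) :+ b := (b :+ s) :+ a) refl (g zero) (f zero) (sum (f ∘ suc))
  where open +-*-Solver
sum-update f g (suc i) eq rewrite eq zero (λ ()) =
  trans (+-assoc (f zero) _ _)
    (trans (cong (f zero +_) (sum-update (f ∘ suc) (g ∘ suc) i
             (λ j j≢i → eq (suc j) λ where refl → j≢i refl)))
           (≡-sym (+-assoc (f zero) _ _)))

sum-≤ : ∀ {m} (f : Fin m → ℕ) b → (∀ i → f i ≤ b) → sum f ≤ m * b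
sum-≤ {zero}  f b f≤b = z≤n
sum-≤ {suc m} f b f≤b = +-mono-≤ (f≤b zero) (sum-≤ (f ∘ suc) b (f≤b ∘ suc))

lookup-injective : ∀ {A : Set} {xs : List A} → Unique xs → Injective _≡_ _≡_ (lookup xs)
lookup-injective (_ ∷ _)  {zero}  {zero}  _  = refl
lookup-injective (x# ∷ _) {zero}  {suc j} eq = contradiction eq (All-lookup x# (∈-lookup j))
lookup-injective (x# ∷ _) {suc i} {zero}  eq = contradiction (≡-sym eq) (All-lookup x# (∈-lookup i))
lookup-injective (_ ∷ u)  {suc i} {suc j} eq = cong suc (lookup-injective u eq)

Unique-length : ∀ {n} {xs : List (Fin n)} → Unique xs → length xs ≤ n
Unique-length u = injective⇒≤ (lookup-injective u)

∷-Unique : ∀ {n} {x : Fin n} {xs} → x ∉ xs → Unique xs → Unique (x ∷ xs)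
∷-Unique {xs = xs} x∉xs u = ¬Any⇒All¬ xs x∉xs ∷ u

sum-indicator : ∀ {A : Set} (p : A → Bool) xs →
  sumList (map (λ w → if p w then 1 else 0) xs) ≡ length (filter (λ w → p w Bool.≟ true) xs)
sum-indicator p [] = refl
sum-indicator p (x ∷ xs) with p x
... | true  = cong suc (sum-indicator p xs)
... | false = sum-indicator p xs

-- `deg` is the length of the list of neighbours, in which distinct `f i` occupy distinct positions.
injection≤deg : ∀ {n m} (G : SimpleGraph n) v (f : Fin m → Fin n) → Injective _≡_ _≡_ f →
  (∀ i → adj G v (f i) ≡ true) → m ≤ deg G v
injection≤deg {n} G v f f-inj f-adj =
  subst (_ ≤_) (≡-sym (sum-indicator (adj G v) (allFin n)))
    (injective⇒≤ {f = λ i → index (mem i)}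
      λ {i} {j} eq → f-inj (Membership.index-injective (setoid _) (mem i) (mem j) eq))
  where
  adj? = λ w → adj G v w Bool.≟ true
  mem : ∀ i → f i ∈ filter adj? (allFin n)
  mem i = ∈-filter⁺ adj? (∈-allFin (f i)) (f-adj i)

-- Partial colourings bounded by `t`, and missing colours.

module Extension {n} (G : SimpleGraph n) (t : Fin n → ℕ) (deg≤t : ∀ v → deg G v ≤ t v) where

  open DecMembership (_≟F_ {n}) using (_∈?_)

  V : Set
  V = Fin n

  -- Colour 0 means "not coloured yet".
  Colouring : Set
  Colouring = V → V → ℕ

  Edge : V → V → Set
  Edge u v = adj G u v ≡ true

  Edge-sym : ∀ {u v} → Edge u v → Edge v u
  Edge-sym {u} {v} e = trans (SimpleGraph.sym G v u) e

  Edge⇒≢ : ∀ {u v} → Edge u v → u ≢ v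
  Edge⇒≢ {u} e refl = case trans (≡-sym e) (loopless G u) of λ ()

  -- Properness is the field `injective`; it exempts colour 0, since several uncoloured edges may
  -- meet at a vertex.
  record Valid (φ : Colouring) : Set where
    field
      symmetric : ∀ u v → φ u v ≡ φ v u
      support   : ∀ {u v} → φ u v ≢ 0 → Edge u v
      injective : ∀ {u v w} → φ u v ≢ 0 → φ u v ≡ φ u w → v ≡ w
      bounded   : ∀ u v → φ u v ≤ t u ⊔ t v
  open Valid

  Missing : Colouring → V → ℕ → Set
  Missing φ v c = ∀ w → φ v w ≢ c

  neighbour? : ∀ (φ : Colouring) v c → (∃ λ w → φ v w ≡ c) ⊎ Missing φ v c
  neighbour? φ v c with any? (λ w → φ v w ≟ℕ c)
  ... | yes found = inj₁ found
  ... | no none   = inj₂ (λ w eq → none (w , eq))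

  MissingBelow : Colouring → V → ℕ → Set
  MissingBelow φ v c = Missing φ v c × c ≢ 0 × c ≤ t v

  missing-or-saturated : ∀ (φ : Colouring) v →
    (∃ λ c → MissingBelow φ v c) ⊎ (∀ (i : Fin (t v)) → ∃ λ w → φ v w ≡ suc (toℕ i))
  missing-or-saturated φ v with all? (λ (i : Fin (t v)) → any? (λ w → φ v w ≟ℕ suc (toℕ i)))
  ... | yes all = inj₂ all
  ... | no ¬all with ¬∀⟶∃¬ _ _ (λ i → any? (λ w → φ v w ≟ℕ suc (toℕ i))) ¬all
  ... | i , none = inj₁ (suc (toℕ i) , (λ w eq → none (w , eq)) , (λ ()) , toℕ<n i)

  suc≢0 : ∀ {m c : ℕ} → m ≡ suc c → m ≢ 0
  suc≢0 refl ()

  saturated⇒injective : ∀ (φ : Colouring) {v} (sat : ∀ (i : Fin (t v)) → ∃ λ w → φ v w ≡ suc (toℕ i)) →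
    Injective _≡_ _≡_ (λ i → proj₁ (sat i))
  saturated⇒injective φ {v} sat {i} {j} eq = toℕ-injective (suc-injective
    (trans (≡-sym (proj₂ (sat i))) (trans (cong (φ v) eq) (proj₂ (sat j)))))

  -- If all colours 1, ..., `t v` occurred at `v`, they would lead to `t v` distinct neighbours,
  -- more than the degree.
  missing-at-deficient : ∀ {φ} → Valid φ → ∀ {v} → deg G v < t v → ∃ λ c → MissingBelow φ v c
  missing-at-deficient {φ} val {v} d<t with missing-or-saturated φ v
  ... | inj₁ m   = m
  ... | inj₂ sat = contradiction
    (injection≤deg G v (λ i → proj₁ (sat i)) (saturated⇒injective φ sat)
      (λ i → support val (suc≢0 (proj₂ (sat i)))))
    (<⇒≱ d<t)

  -- This also covers `deg G v ≡ t v`: the uncoloured neighbour `w` is not reached by any colour, so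
  -- a saturated `v` would have `suc (t v)` neighbours.
  missing-at-uncoloured : ∀ {φ} → Valid φ → ∀ {v w} → Edge v w → φ v w ≡ 0 →
    ∃ λ c → MissingBelow φ v c
  missing-at-uncoloured {φ} val {v} {w} e unc with missing-or-saturated φ v
  ... | inj₁ m   = m
  ... | inj₂ sat = contradiction (injection≤deg G v f f-inj f-adj) (≤⇒≯ (deg≤t v))
    where
    f : Fin (suc (t v)) → V
    f zero    = w
    f (suc i) = proj₁ (sat i)
    w-new : ∀ i → w ≢ proj₁ (sat i)
    w-new i refl = suc≢0 (proj₂ (sat i)) unc
    f-inj : Injective _≡_ _≡_ f
    f-inj {zero}  {zero}  _  = refl
    f-inj {zero}  {suc j} eq = contradiction eq (w-new j)
    f-inj {suc i} {zero}  eq = contradiction (≡-sym eq) (w-new i)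
    f-inj {suc i} {suc j} eq = cong suc (saturated⇒injective φ sat eq)
    f-adj : ∀ i → Edge v (f i)
    f-adj zero    = e
    f-adj (suc i) = support val (suc≢0 (proj₂ (sat i)))

  -- Recolouring one edge: effect on weights and validity.

  Same : V → V → V → V → Set
  Same a b u v = (u ≡ a × v ≡ b) ⊎ (u ≡ b × v ≡ a)

  same? : ∀ a b u v → Dec (Same a b u v)
  same? a b u v = ((u ≟F a) ×-dec (v ≟F b)) ⊎-dec ((u ≟F b) ×-dec (v ≟F a))

  Same-swap : ∀ {a b u v} → Same a b u v → Same a b v u
  Same-swap (inj₁ (p , q)) = inj₂ (q , p)
  Same-swap (inj₂ (p , q)) = inj₁ (q , p)

  Weight : Set
  Weight = V → ℕ → ℕ

  -- The sum runs over ordered pairs, so an edge contributes once from each end, and `w` may rate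
  -- its colour differently at the two ends.
  total : Weight → Colouring → ℕ
  total w φ = sum (λ u → sum (λ v → w u (φ u v)))

  abstract
    assign : Colouring → V → V → ℕ → Colouring
    assign φ a b c u v with (u ≟F a) ×-dec (v ≟F b)
    ... | yes _ = c
    ... | no  _ = φ u v

    assign-at : ∀ φ a b c → assign φ a b c a b ≡ c
    assign-at φ a b c with (a ≟F a) ×-dec (b ≟F b)
    ... | yes _ = refl
    ... | no ne = contradiction (refl , refl) ne

    assign-off : ∀ φ a b c {u v} → ¬ (u ≡ a × v ≡ b) → assign φ a b c u v ≡ φ u v
    assign-off φ a b c {u} {v} ne with (u ≟F a) ×-dec (v ≟F b)
    ... | yes eq = contradiction eq ne
    ... | no _   = refl

  recolour : Colouring → V → V → ℕ → Colouring
  recolour φ a b c = assign (assign φ a b c) b a c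

  recolour-at : ∀ φ a b c {u v} → Same a b u v → recolour φ a b c u v ≡ c
  recolour-at φ a b c (inj₂ (refl , refl)) = assign-at _ b a c
  recolour-at φ a b c (inj₁ (refl , refl)) with (a ≟F b) ×-dec (b ≟F a)
  ... | yes (refl , refl) = assign-at _ b a c
  ... | no ne = trans (assign-off _ b a c ne) (assign-at φ a b c)

  recolour-off : ∀ φ a b c {u v} → ¬ Same a b u v → recolour φ a b c u v ≡ φ u v
  recolour-off φ a b c ne =
    trans (assign-off _ b a c (ne ∘ inj₂)) (assign-off φ a b c (ne ∘ inj₁))

  -- `sum-update` is used twice: within row `a` only entry `b` changes, and among the rows only row
  -- `a` changes. The old row sum then cancels.
  total-assign : ∀ w φ a b c → total w (assign φ a b c) + w a (φ a b) ≡ total w φ + w a c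
  total-assign w φ a b c = +-cancelʳ-≡ (row φ) _ _ (begin
    total w ψ + w a (φ a b) + row φ  ≡⟨ shuffle (total w ψ) _ _ ⟩
    (total w ψ + row φ) + w a (φ a b)  ≡⟨ cong (_+ w a (φ a b)) outer ⟩
    (total w φ + row ψ) + w a (φ a b)  ≡⟨ +-assoc (total w φ) _ _ ⟩
    total w φ + (row ψ + w a (φ a b))  ≡⟨ cong (total w φ +_) inner ⟩
    total w φ + (row φ + w a (ψ a b))  ≡⟨ cong (λ x → total w φ + (row φ + w a x)) (assign-at φ a b c) ⟩
    total w φ + (row φ + w a c)  ≡⟨ cong (total w φ +_) (+-comm (row φ) _) ⟩
    total w φ + (w a c + row φ)  ≡⟨ +-assoc (total w φ) _ _ ⟨
    total w φ + w a c + row φ  ∎)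
    where
    open ≡-Reasoning
    ψ = assign φ a b c
    row : Colouring → ℕ
    row χ = sum (λ v → w a (χ a v))
    shuffle : ∀ x y z → x + y + z ≡ x + z + y
    shuffle = solve 3 (λ x y z → (x :+ y) :+ z := (x :+ z) :+ y) refl
      where open +-*-Solver
    inner : row ψ + w a (φ a b) ≡ row φ + w a (ψ a b)
    inner = sum-update (λ v → w a (φ a v)) (λ v → w a (ψ a v)) b
      (λ v v≢b → cong (w a) (assign-off φ a b c (v≢b ∘ proj₂)))
    outer : total w ψ + row φ ≡ total w φ + row ψ
    outer = sum-update (λ u → sum (λ v → w u (φ u v))) (λ u → sum (λ v → w u (ψ u v))) a
      (λ u u≢a → sum-cong-≗ {n} (λ v → cong (w u) (assign-off φ a b c (u≢a ∘ proj₁))))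

  total-recolour : ∀ w φ {a b} c → a ≢ b →
    total w (recolour φ a b c) + (w a (φ a b) + w b (φ b a)) ≡ total w φ + (w a c + w b c)
  total-recolour w φ {a} {b} c a≢b = begin
    total w (recolour φ a b c) + (x + y)  ≡⟨ cong (total w (recolour φ a b c) +_) (+-comm x y) ⟩
    total w (recolour φ a b c) + (y + x)  ≡⟨ +-assoc (total w (recolour φ a b c)) y x ⟨
    total w (recolour φ a b c) + y + x  ≡⟨ cong (λ s → total w (recolour φ a b c) + w b s + x)
                                             (assign-off φ a b c (≢-sym a≢b ∘ proj₁)) ⟨
    total w (recolour φ a b c) + w b (ψ b a) + x  ≡⟨ cong (_+ x) (total-assign w ψ b a c) ⟩
    total w ψ + w b c + x  ≡⟨ +-assoc (total w ψ) _ _ ⟩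
    total w ψ + (w b c + x)  ≡⟨ cong (total w ψ +_) (+-comm (w b c) x) ⟩
    total w ψ + (x + w b c)  ≡⟨ +-assoc (total w ψ) x _ ⟨
    total w ψ + x + w b c  ≡⟨ cong (_+ w b c) (total-assign w φ a b c) ⟩
    total w φ + w a c + w b c  ≡⟨ +-assoc (total w φ) _ _ ⟩
    total w φ + (w a c + w b c)  ∎
    where
    open ≡-Reasoning
    ψ = assign φ a b c
    x = w a (φ a b)
    y = w b (φ b a)

  recolour-symmetric : ∀ {φ} → Valid φ → ∀ a b c u v → recolour φ a b c u v ≡ recolour φ a b c v u
  recolour-symmetric {φ} val a b c u v with same? a b u v
  ... | yes s = trans (recolour-at φ a b c s) (≡-sym (recolour-at φ a b c (Same-swap s)))
  ... | no ¬s = trans (recolour-off φ a b c ¬s)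
    (trans (symmetric val u v) (≡-sym (recolour-off φ a b c (¬s ∘ Same-swap))))

  erase-valid : ∀ {φ} → Valid φ → ∀ a b → Valid (recolour φ a b 0)
  erase-valid {φ} val a b = record
    { symmetric = recolour-symmetric val a b 0
    ; support   = λ {u} {v} nz → support val (subst (_≢ 0) (off nz) nz)
    ; injective = λ {u} {v} {w} nz eq → injective val (subst (_≢ 0) (off nz) nz)
        (trans (≡-sym (off nz)) (trans eq (off (subst (_≢ 0) eq nz))))
    ; bounded   = bnd
    }
    where
    off : ∀ {u v} → recolour φ a b 0 u v ≢ 0 → recolour φ a b 0 u v ≡ φ u v
    off nz = recolour-off φ a b 0 (nz ∘ recolour-at φ a b 0)
    bnd : ∀ u v → recolour φ a b 0 u v ≤ t u ⊔ t v
    bnd u v with same? a b u v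
    ... | yes s = subst (_≤ _) (≡-sym (recolour-at φ a b 0 s)) z≤n
    ... | no ¬s = subst (_≤ _) (≡-sym (recolour-off φ a b 0 ¬s)) (bounded val u v)

  paint-valid : ∀ {φ} → Valid φ → ∀ {a b c} → Edge a b → Missing φ a c → Missing φ b c →
    c ≤ t a ⊔ t b → Valid (recolour φ a b c)
  paint-valid {φ} val {a} {b} {c} e a∌c b∌c c≤ = record
    { symmetric = recolour-symmetric val a b c
    ; support   = sup
    ; injective = inj
    ; bounded   = bnd
    }
    where
    at = recolour-at φ a b c
    off = recolour-off φ a b c
    sup : ∀ {u v} → recolour φ a b c u v ≢ 0 → Edge u v
    sup {u} {v} nz with same? a b u v
    ... | yes (inj₁ (refl , refl)) = e
    ... | yes (inj₂ (refl , refl)) = Edge-sym e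
    ... | no ¬s = support val (nz ∘ trans (off ¬s))
    unique : ∀ {u v w} → Same a b u v → Same a b u w → v ≡ w
    unique (inj₁ (refl , refl)) (inj₁ (_ , refl)) = refl
    unique (inj₁ (refl , refl)) (inj₂ (refl , _)) = contradiction refl (Edge⇒≢ e)
    unique (inj₂ (refl , refl)) (inj₁ (refl , _)) = contradiction refl (Edge⇒≢ e)
    unique (inj₂ (refl , refl)) (inj₂ (_ , refl)) = refl
    fresh : ∀ {u v w} → Same a b u v → φ u w ≢ c
    fresh (inj₁ (refl , refl)) = a∌c _
    fresh (inj₂ (refl , refl)) = b∌c _
    inj : ∀ {u v w} → recolour φ a b c u v ≢ 0 → recolour φ a b c u v ≡ recolour φ a b c u w → v ≡ w
    inj {u} {v} {w} nz eq with same? a b u v | same? a b u w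
    ... | yes s | yes s′ = unique s s′
    ... | yes s | no ¬s′ = contradiction (trans (≡-sym (off ¬s′)) (trans (≡-sym eq) (at s))) (fresh s)
    ... | no ¬s | yes s′ = contradiction (trans (≡-sym (off ¬s)) (trans eq (at s′))) (fresh s′)
    ... | no ¬s | no ¬s′ = injective val (nz ∘ trans (off ¬s))
      (trans (≡-sym (off ¬s)) (trans eq (off ¬s′)))
    bnd : ∀ u v → recolour φ a b c u v ≤ t u ⊔ t v
    bnd u v with same? a b u v
    ... | yes s@(inj₁ (refl , refl)) = subst (_≤ _) (≡-sym (at s)) c≤
    ... | yes s@(inj₂ (refl , refl)) = subst (_≤ _) (≡-sym (at s)) (subst (c ≤_) (⊔-comm (t a) (t b)) c≤)
    ... | no ¬s = subst (_≤ _) (≡-sym (off ¬s)) (bounded val u v)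

  Null : Weight → Set
  Null w = ∀ u → w u 0 ≡ 0

  total-paint : ∀ {w} → Null w → ∀ {φ} → Valid φ → ∀ {a b} c → Edge a b → φ a b ≡ 0 →
    total w (recolour φ a b c) ≡ total w φ + (w a c + w b c)
  total-paint {w} null {φ} val {a} {b} c e unc = begin
    total w (recolour φ a b c)  ≡⟨ +-identityʳ _ ⟨
    total w (recolour φ a b c) + (0 + 0)
      ≡⟨ cong₂ (λ x y → total w (recolour φ a b c) + (x + y)) (zero-at a unc)
           (zero-at b (trans (symmetric val b a) unc)) ⟨
    total w (recolour φ a b c) + (w a (φ a b) + w b (φ b a))  ≡⟨ total-recolour w φ c (Edge⇒≢ e) ⟩
    total w φ + (w a c + w b c)  ∎
    where
    open ≡-Reasoning
    zero-at : ∀ u {d} → d ≡ 0 → w u d ≡ 0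
    zero-at u refl = null u

  total-erase : ∀ {w} → Null w → ∀ {φ} → Valid φ → ∀ {a b} → φ a b ≢ 0 →
    total w (recolour φ a b 0) + (w a (φ a b) + w b (φ a b)) ≡ total w φ
  total-erase {w} null {φ} val {a} {b} nz = begin
    total w (recolour φ a b 0) + (w a (φ a b) + w b (φ a b))
      ≡⟨ cong (λ x → total w (recolour φ a b 0) + (w a (φ a b) + w b x)) (symmetric val a b) ⟩
    total w (recolour φ a b 0) + (w a (φ a b) + w b (φ b a))
      ≡⟨ total-recolour w φ 0 (Edge⇒≢ (support val nz)) ⟩
    total w φ + (w a 0 + w b 0)  ≡⟨ cong₂ (λ x y → total w φ + (x + y)) (null a) (null b) ⟩
    total w φ + 0  ≡⟨ +-identityʳ _ ⟩
    total w φ  ∎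
    where open ≡-Reasoning

  -- Slides: moving a colour between two edges at a vertex.

  record Slide (φ : Colouring) (x y z : V) (c : ℕ) (φ′ : Colouring) : Set where
    field
      valid     : Valid φ
      valid′    : Valid φ′
      edge-y    : Edge x y
      edge-z    : Edge x z
      colour-y  : φ x y ≡ 0
      colour-z  : φ x z ≡ c
      nonzero   : c ≢ 0
      colour-y′ : φ′ x y ≡ c
      colour-z′ : φ′ x z ≡ 0
      elsewhere : ∀ {u v} → ¬ Same x y u v → ¬ Same x z u v → φ′ u v ≡ φ u v
      -- The centre `x` keeps `c`, merely on another edge, so only the gain at `y` and the loss at
      -- `z` count.
      balance   : ∀ {w} → Null w → total w φ′ + w z c ≡ total w φ + w y c

  slide : ∀ {φ} → Valid φ → ∀ {x y z c} → Edge x y → φ x y ≡ 0 → φ x z ≡ c → c ≢ 0 →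
    Missing φ y c → c ≤ t x ⊔ t y → ∃ λ φ′ → Slide φ x y z c φ′
  slide {φ} val {x} {y} {z} {c} e unc refl nz y∌c c≤ = φ′ , record
    { valid     = val
    ; valid′    = paint-valid valₑ e x∌c y∌cₑ c≤
    ; edge-y    = e
    ; edge-z    = support val nz
    ; colour-y  = unc
    ; colour-z  = refl
    ; nonzero   = nz
    ; colour-y′ = recolour-at φₑ x y c (inj₁ (refl , refl))
    ; colour-z′ = trans (recolour-off φₑ x y c λ where
        (inj₁ (_ , refl)) → nz unc
        (inj₂ (refl , _)) → Edge⇒≢ e refl) erased
    ; elsewhere = λ ¬y ¬z → trans (recolour-off φₑ x y c ¬y) (recolour-off φ x z 0 ¬z)
    ; balance   = λ {w} → bal {w}
    }
    where
    φₑ = recolour φ x z 0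
    φ′ = recolour φₑ x y c
    valₑ = erase-valid val x z
    erased : φₑ x z ≡ 0
    erased = recolour-at φ x z 0 (inj₁ (refl , refl))
    φₑ-old : ∀ {u v} → φₑ u v ≡ c → φ u v ≡ c × ¬ Same x z u v
    φₑ-old {u} {v} eq with same? x z u v
    ... | yes s = contradiction (trans (≡-sym eq) (recolour-at φ x z 0 s)) nz
    ... | no ¬s = trans (≡-sym (recolour-off φ x z 0 ¬s)) eq , ¬s
    y∌cₑ : Missing φₑ y c
    y∌cₑ v eq = y∌c v (proj₁ (φₑ-old eq))
    -- By properness `xz` was the only edge of colour `c` at `x`, and it has just been erased.
    x∌c : Missing φₑ x c
    x∌c v eq with φₑ-old eq
    ... | φxv , ¬s = ¬s (inj₁ (refl , ≡-sym (injective val nz (≡-sym φxv))))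
    uncₑ : φₑ x y ≡ 0
    uncₑ with same? x z x y
    ... | yes s = recolour-at φ x z 0 s
    ... | no ¬s = trans (recolour-off φ x z 0 ¬s) unc
    bal : ∀ {w} → Null w → total w φ′ + w z c ≡ total w φ + w y c
    bal {w} null = begin
      total w φ′ + w z c  ≡⟨ cong (_+ w z c) (total-paint {w} null valₑ c e uncₑ) ⟩
      total w φₑ + (w x c + w y c) + w z c  ≡⟨ shuffle (total w φₑ) (w x c) (w y c) (w z c) ⟩
      total w φₑ + (w x c + w z c) + w y c  ≡⟨ cong (_+ w y c) (total-erase {w} null val nz) ⟩
      total w φ + w y c  ∎
      where
      open ≡-Reasoning
      shuffle : ∀ p q r s → p + (q + r) + s ≡ p + (q + s) + r
      shuffle = solve 4 (λ p q r s → (p :+ (q :+ r)) :+ s := (p :+ (q :+ s)) :+ r) refl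
        where open +-*-Solver

  module SlideProperties {φ x y z c φ′} (s : Slide φ x y z c φ′) where
    open Slide s

    y≢z : y ≢ z
    y≢z refl = nonzero (trans (≡-sym colour-z) colour-y)

    trace : ∀ {u v} → φ′ u v ≢ 0 → φ′ u v ≡ φ u v ⊎ (Same x y u v × φ′ u v ≡ c)
    trace {u} {v} nz with same? x y u v | same? x z u v
    ... | yes p@(inj₁ (refl , refl)) | _ = inj₂ (p , colour-y′)
    ... | yes p@(inj₂ (refl , refl)) | _ = inj₂ (p , trans (symmetric valid′ _ _) colour-y′)
    ... | no _ | yes (inj₁ (refl , refl)) = contradiction colour-z′ nz
    ... | no _ | yes (inj₂ (refl , refl)) = contradiction (trans (symmetric valid′ _ _) colour-z′) nz
    ... | no ¬y | no ¬z = inj₁ (elsewhere ¬y ¬z)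

    at-centre : ∀ {v} → v ≢ y → v ≢ z → φ′ x v ≡ φ x v
    at-centre v≢y v≢z = elsewhere
      (λ where
        (inj₁ (_ , v≡y)) → v≢y v≡y
        (inj₂ (x≡y , _)) → Edge⇒≢ edge-y x≡y)
      (λ where
        (inj₁ (_ , v≡z)) → v≢z v≡z
        (inj₂ (x≡z , _)) → Edge⇒≢ edge-z x≡z)

    -- The only vertex that acquires a new colour is `y`, which acquires `c`; the centre `x` had `c`
    -- already, on `xz`.
    keep-missing : ∀ {u e} → e ≢ 0 → (u ≡ y → e ≢ c) → Missing φ u e → Missing φ′ u e
    keep-missing e≢0 ne u∌e v refl with trace e≢0
    ... | inj₁ eq = u∌e v (≡-sym eq)
    ... | inj₂ (inj₁ (refl , _) , eq) = u∌e z (trans colour-z (≡-sym eq))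
    ... | inj₂ (inj₂ (u≡y , _) , eq) = ne u≡y eq

    freed-missing : Missing φ′ z c
    freed-missing v eq with trace (nonzero ∘ trans (≡-sym eq))
    ... | inj₂ (inj₁ (refl , _) , _) = Edge⇒≢ edge-z refl
    ... | inj₂ (inj₂ (refl , _) , _) = y≢z refl
    ... | inj₁ old with injective valid (nonzero ∘ trans (≡-sym (trans (≡-sym old) eq)))
                          (trans (≡-sym old) (trans eq (trans (≡-sym colour-z) (symmetric valid x z))))
    ... | refl = nonzero (trans (≡-sym eq) (trans (symmetric valid′ z x) colour-z′))

  -- Size and saturation as measures of progress.

  size-weight : Weight
  size-weight _ zero    = 0
  size-weight _ (suc _) = 1

  -- In a valid colouring a colour occurs at most once at a vertex, so the total counts the pairs
  -- (u, c) with `c ≤ t u` and `c` present at `u`.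
  sat-weight : Weight
  sat-weight _ zero = 0
  sat-weight u (suc c) with suc c ≤? t u
  ... | yes _ = 1
  ... | no _  = 0

  size saturation : Colouring → ℕ
  size = total size-weight
  saturation = total sat-weight

  size-weight-positive : ∀ {c} u → c ≢ 0 → size-weight u c ≡ 1
  size-weight-positive {zero}  u nz = contradiction refl nz
  size-weight-positive {suc c} u nz = refl

  sat-weight-low : ∀ {u c} → c ≢ 0 → c ≤ t u → sat-weight u c ≡ 1
  sat-weight-low {u} {zero}  nz c≤ = contradiction refl nz
  sat-weight-low {u} {suc c} nz c≤ with suc c ≤? t u
  ... | yes _ = refl
  ... | no c≰ = contradiction c≤ c≰

  sat-weight-high : ∀ {u c} → t u < c → sat-weight u c ≡ 0
  sat-weight-high {u} {suc c} t< with suc c ≤? t u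
  ... | yes c≤ = contradiction c≤ (<⇒≱ t<)
  ... | no _ = refl

  size-weight≤1 : ∀ u c → size-weight u c ≤ 1
  size-weight≤1 u zero    = z≤n
  size-weight≤1 u (suc c) = ≤-refl

  sat-weight≤1 : ∀ u c → sat-weight u c ≤ 1
  sat-weight≤1 u zero = z≤n
  sat-weight≤1 u (suc c) with suc c ≤? t u
  ... | yes _ = ≤-refl
  ... | no _ = z≤n

  total≤ : ∀ w → (∀ u c → w u c ≤ 1) → ∀ φ → total w φ ≤ n * (n * 1)
  total≤ w w≤1 φ = sum-≤ _ _ (λ u → sum-≤ _ 1 (λ v → w≤1 u (φ u v)))

  infix 4 _⊏_ _⊑_

  _⊏_ : Colouring → Colouring → Set
  φ ⊏ φ′ = size φ < size φ′ ⊎ (size φ ≡ size φ′ × saturation φ < saturation φ′)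

  -- The invariant kept while a fixed starting colouring is being rearranged: any strict gain made
  -- later is still a gain over the start.
  _⊑_ : Colouring → Colouring → Set
  φ ⊑ φ′ = size φ ≡ size φ′ × saturation φ ≤ saturation φ′

  Improvable : Colouring → Set
  Improvable φ = ∃ λ φ′ → Valid φ′ × φ ⊏ φ′

  slide-size : ∀ {φ x y z c φ′} → Slide φ x y z c φ′ → size φ ≡ size φ′
  slide-size {φ} {x} {y} {z} {c} {φ′} s = ≡-sym (+-cancelʳ-≡ 1 _ _
    (subst (λ k → size φ′ + k ≡ size φ + k) (size-weight-positive z (Slide.nonzero s))
      (trans (Slide.balance s {size-weight} (λ _ → refl))
        (cong (size φ +_) (trans (size-weight-positive y (Slide.nonzero s))
          (≡-sym (size-weight-positive z (Slide.nonzero s))))))))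

  slide-saturation : ∀ {φ x y z c φ′} → Slide φ x y z c φ′ →
    saturation φ′ + sat-weight z c ≡ saturation φ + sat-weight y c
  slide-saturation s = Slide.balance s {sat-weight} (λ _ → refl)

  -- The colour gained by `y` counts because `c ≤ t y`, while `z` loses at most one counted colour.
  slide-⊑ : ∀ {φ x y z c φ′} → Slide φ x y z c φ′ → c ≤ t y → φ ⊑ φ′
  slide-⊑ {φ} {x} {y} {z} {c} {φ′} s c≤ = slide-size s , +-cancelʳ-≤ 1 _ _ (begin
    saturation φ + 1  ≡⟨ cong (saturation φ +_) (sat-weight-low (Slide.nonzero s) c≤) ⟨
    saturation φ + sat-weight y c  ≡⟨ slide-saturation s ⟨
    saturation φ′ + sat-weight z c  ≤⟨ +-monoʳ-≤ _ (sat-weight≤1 z c) ⟩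
    saturation φ′ + 1  ∎)
    where open ≤-Reasoning

  -- Only the sizes are compared: a larger size wins whatever happens to the saturation.
  paint-improves : ∀ {φ₀ φ} → size φ₀ ≡ size φ → Valid φ → ∀ {a b c} → Edge a b → φ a b ≡ 0 →
    c ≢ 0 → Missing φ a c → Missing φ b c → c ≤ t a ⊔ t b → Improvable φ₀
  paint-improves {φ₀} {φ} eq val {a} {b} {c} e unc nz a∌c b∌c c≤ =
    recolour φ a b c , paint-valid val e a∌c b∌c c≤ , inj₁ (begin-strict
      size φ₀  ≡⟨ eq ⟩
      size φ  <⟨ m<m+n (size φ) {suc (size-weight b c)} (s≤s z≤n) ⟩
      size φ + suc (size-weight b c)  ≡⟨ cong (λ k → size φ + (k + size-weight b c)) (size-weight-positive a nz) ⟨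
      size φ + (size-weight a c + size-weight b c)  ≡⟨ total-paint {size-weight} (λ _ → refl) val c e unc ⟨
      size (recolour φ a b c)  ∎)
    where open ≤-Reasoning

  -- Vizing fans.

  -- The slides that created the fan have already been carried out: xy is the uncoloured edge,
  -- and sliding along the list takes the colours back to where they came from.
  data Fan (φ : Colouring) (x : V) : V → List V → V → Set where
    []  : ∀ {y} → Fan φ x y [] y
    _∷_ : ∀ {y z L q} → Missing φ y (φ x z) × φ x z ≢ 0 × φ x z ≤ t x ⊔ t y × z ∉ L →
          Fan φ x z L q → Fan φ x y (z ∷ L) q

  Fan-coloured : ∀ {φ x y L q} → Fan φ x y L q → ∀ {l} → l ∈ L → φ x l ≢ 0
  Fan-coloured ((_ , nz , _) ∷ fan) (here refl) = nz
  Fan-coloured (_ ∷ fan) (there l∈) = Fan-coloured fan l∈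

  -- A fan depends only on the colours from `x` to the members of `L` and on where these colours are
  -- missing among the fan vertices.
  Fan-transport : ∀ {φ φ′ x y L q} → (∀ {l} → l ∈ L → φ′ x l ≡ φ x l) →
    (∀ {u l} → u ∈ y ∷ L → l ∈ L → Missing φ u (φ x l) → Missing φ′ u (φ x l)) →
    Fan φ x y L q → Fan φ′ x y L q
  Fan-transport same miss [] = []
  Fan-transport {φ′ = φ′} {x} {y} same miss ((y∌ , nz , ok , z∉L) ∷ fan) =
    ( subst (Missing φ′ y) (≡-sym eq) (miss (here refl) (here refl) y∌)
    , subst (_≢ 0) (≡-sym eq) nz
    , subst (_≤ t x ⊔ t y) (≡-sym eq) ok
    , z∉L)
    ∷ Fan-transport (same ∘ there) (λ u∈ l∈ → miss (there u∈) (there l∈)) fan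
    where eq = same (here refl)

  -- The slide adds a colour to `y` only, and `y` is not in the rest of the fan, whose members are
  -- joined to `x` by coloured edges.
  Fan-slide : ∀ {φ φ′ x y z L q c} → Slide φ x y z c φ′ → Fan φ x z L q → z ∉ L → Fan φ′ x z L q
  Fan-slide {φ} {φ′} {x} {y} {z} {L} s fan z∉L = Fan-transport
    (λ l∈ → at-centre (≢y l∈) λ where refl → z∉L l∈)
    (λ u∈ l∈ → keep-missing (Fan-coloured fan l∈) λ u≡y → contradiction u≡y (∈≢y u∈))
    fan
    where
    open Slide s
    open SlideProperties s
    ≢y : ∀ {l} → l ∈ L → l ≢ y
    ≢y l∈ refl = Fan-coloured fan l∈ colour-y
    ∈≢y : ∀ {u} → u ∈ z ∷ L → u ≢ y
    ∈≢y (here refl) = ≢-sym y≢z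
    ∈≢y (there u∈)  = ≢y u∈

  -- Sliding along the whole fan makes `xq` the uncoloured edge. No slide moves `β`, because `x`
  -- misses it, so `xq` can finally be painted `β`.
  Fan-improves : ∀ {φ₀ φ x y L q β} → size φ₀ ≡ size φ → Valid φ → Edge x y → φ x y ≡ 0 →
    Fan φ x y L q → Missing φ x β → Missing φ q β → β ≢ 0 → β ≤ t x ⊔ t q → Improvable φ₀
  Fan-improves sz val e unc [] x∌β q∌β β≢0 β≤ = paint-improves sz val e unc β≢0 x∌β q∌β β≤
  Fan-improves sz val e unc ((y∌ , nz , ok , z∉L) ∷ fan) x∌β q∌β β≢0 β≤
    with slide val e unc refl nz y∌ ok
  ... | φ′ , s = Fan-improves (trans sz (slide-size s)) valid′ edge-z colour-z′
    (Fan-slide s fan z∉L)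
    (keep-missing β≢0 (λ where refl → contradiction refl (Edge⇒≢ e)) x∌β)
    (keep-missing β≢0 (λ _ β≡c → x∌β _ (≡-sym β≡c)) q∌β) β≢0 β≤
    where
    open Slide s
    open SlideProperties s

  -- The part of the fan before `p`. Its last vertex misses the colour of `xp`; `end-pos` separates
  -- the degenerate case where `p` comes first and `end` is `y` itself.
  record Cut (φ : Colouring) (x y p : V) (L : List V) : Set where
    field
      {end}    : V
      {prefix} : List V
      fan      : Fan φ x y prefix end
      missing  : Missing φ end (φ x p)
      allowed  : φ x p ≤ t x ⊔ t end
      prefix⊆  : ∀ {l} → l ∈ prefix → l ∈ L
      p∉prefix : p ∉ prefix
      end-pos  : (∃ λ L′ → L ≡ p ∷ L′) ⊎ end ∈ prefix

  cut : ∀ {φ x y L q p} → Fan φ x y L q → p ∈ L → Cut φ x y p L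
  cut ((y∌ , _ , ok , _) ∷ _) (here refl) = record
    { fan = [] ; missing = y∌ ; allowed = ok ; prefix⊆ = λ () ; p∉prefix = λ () ; end-pos = inj₁ (_ , refl) }
  cut {L = z ∷ L} {p = p} ((y∌ , nz , ok , z∉L) ∷ fan) (there p∈) = record
    { fan      = (y∌ , nz , ok , z∉L ∘ C.prefix⊆) ∷ C.fan
    ; missing  = C.missing
    ; allowed  = C.allowed
    ; prefix⊆  = λ where
        (here refl) → here refl
        (there l∈)  → there (C.prefix⊆ l∈)
    ; p∉prefix = λ where
        (here refl) → z∉L p∈
        (there p∈′) → C.p∉prefix p∈′
    ; end-pos  = inj₂ (end∈ C.fan)
    }
    where
    module C = Cut (cut fan p∈)
    end∈ : ∀ {φ x y L q} → Fan φ x y L q → q ∈ y ∷ L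
    end∈ []        = here refl
    end∈ (_ ∷ fan) = there (end∈ fan)

  -- Swapping a Kempe chain.

  -- The α/β chain through x is swapped one slide at a time, starting from the uncoloured edge xz
  -- (x misses α, z misses β). Unless φ₀ is improved on the way, the walk comes back to xz with
  -- x now missing β. The vertex q is a second fan vertex missing β: since the chain already ends
  -- at x and z, it stays untouched, which is what makes the flip useful.
  module Kempe (φ₀ ψ : Colouring) (x z q : V) (α β : ℕ)
               (α≢0 : α ≢ 0) (β≢0 : β ≢ 0) (β≤tz : β ≤ t z) where

    -- Colours other than `α` and `β` are untouched by the swap; this is what lets a piece of the
    -- fan survive it.
    record Agrees (φ : Colouring) : Set where
      field
        colours : ∀ {u v} → ψ u v ≢ 0 → ψ u v ≢ α → ψ u v ≢ β → φ u v ≡ ψ u v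
        missing : ∀ {u e} → e ≢ 0 → e ≢ α → e ≢ β → Missing ψ u e → Missing φ u e

    Agrees-refl : Agrees ψ
    Agrees-refl = record { colours = λ _ _ _ → refl ; missing = λ _ _ _ m → m }

    Agrees-slide : ∀ {φ φ′ a b d c} → Agrees φ → Slide φ a b d c φ′ → c ≡ α ⊎ c ≡ β → Agrees φ′
    Agrees-slide {φ} {φ′} {a} {b} {d} {c} ag s c∈ = record
      { colours = λ {u} {v} nz ≢α ≢β → let eq = Agrees.colours ag nz ≢α ≢β in
          trans (elsewhere
            (λ p → nz (trans (≡-sym eq) (on-Same p colour-y)))
            (λ p → [ (λ c≡α → ≢α (trans (≡-sym eq) (trans (on-Same p colour-z) c≡α)))
                   , (λ c≡β → ≢β (trans (≡-sym eq) (trans (on-Same p colour-z) c≡β))) ]′ c∈))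
            eq
      ; missing = λ nz ≢α ≢β m → keep-missing nz
          (λ _ e≡c → [ (λ c≡α → ≢α (trans e≡c c≡α)) , (λ c≡β → ≢β (trans e≡c c≡β)) ]′ c∈)
          (Agrees.missing ag nz ≢α ≢β m)
      }
      where
      open Slide s
      open SlideProperties s
      on-Same : ∀ {a b u v k} → Same a b u v → φ a b ≡ k → φ u v ≡ k
      on-Same (inj₁ (refl , refl)) eq = eq
      on-Same (inj₂ (refl , refl)) eq = trans (symmetric valid _ _) eq

    record Flipped (φ : Colouring) : Set where
      field
        valid       : Valid φ
        uncoloured  : φ x z ≡ 0
        same-size   : size φ₀ ≡ size φ
        x-missing   : Missing φ x β
        q-missing   : Missing φ q β
        agrees      : Agrees φ

    -- uv is the current uncoloured edge, c its next colour, and S the vertices already passed.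
    record State (φ : Colouring) (u v : V) (c d : ℕ) (S : List V) : Set where
      field
        valid      : Valid φ
        edge       : Edge u v
        uncoloured : φ u v ≡ 0
        u-missing  : Missing φ u c
        v-missing  : Missing φ v d
        colours    : (c ≡ α × d ≡ β) ⊎ (c ≡ β × d ≡ α)
        same-size  : size φ₀ ≡ size φ
        potential  : saturation φ₀ + 2 ≤ saturation φ + (sat-weight u c + sat-weight v d)
        agrees     : Agrees φ
        unique     : Unique S
        u∈S        : u ∈ S
        v∉S        : v ∉ S
        x∈S        : x ∈ S
        z∈S        : z ∈ S
        -- Hence the walk cannot re-enter `S` except at `z`. That vertex is exempt because its
        -- `α`-edge may still lead out of `S`, and the walk may return along it.
        closed     : ∀ {w s} → w ∈ S → w ≢ z → φ w s ≡ α ⊎ φ w s ≡ β → s ∈ S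
        zx-colour  : φ z x ≡ β
        q-missing  : Missing φ q β
        q∉S        : q ∉ S
        q-arrival  : q ≡ v → c ≡ β

    -- Each move adds `v` to the duplicate-free list `S`, so the fuel suffices. The walk stops when
    -- the bound forbids `c` on `uv`, when `v` misses `c` and `uv` can be painted, or when it
    -- returns to `z`.
    walk : ∀ fuel {φ u v c d S} → n < fuel + length S → State φ u v c d S →
      Improvable φ₀ ⊎ ∃ Flipped
    walk zero n< st = contradiction (Unique-length (State.unique st)) (<⇒≱ n<)
    walk (suc fuel) {φ} {u} {v} {c} {d} {S} n< st = step
      where
      open State st
      c∈ : c ≡ α ⊎ c ≡ β
      c∈ = [ inj₁ ∘ proj₁ , inj₂ ∘ proj₁ ]′ colours
      either : ∀ {k} → c ≡ α ⊎ c ≡ β → k ≡ c → k ≡ α ⊎ k ≡ β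
      either (inj₁ refl) = inj₁
      either (inj₂ refl) = inj₂
      c≢0 : c ≢ 0
      c≢0 = [ (λ c≡α → α≢0 ∘ trans (≡-sym c≡α)) , (λ c≡β → β≢0 ∘ trans (≡-sym c≡β)) ]′ c∈
      d≢0 : d ≢ 0
      d≢0 = [ (λ p → β≢0 ∘ trans (≡-sym (proj₂ p))) , (λ p → α≢0 ∘ trans (≡-sym (proj₂ p))) ]′ colours

      -- The walk is stopped by the bound on the colour of uv only if c exceeds both t u and
      -- t v, and then c does not count towards the potential.
      blocked : ¬ c ≤ t u ⊔ t v → Improvable φ₀
      blocked c≰ = φ , valid , inj₂ (same-size , +-cancelʳ-≤ 1 _ _ (begin
        suc (saturation φ₀) + 1  ≡⟨ +-suc (saturation φ₀) 1 ⟨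
        saturation φ₀ + 2  ≤⟨ potential ⟩
        saturation φ + (sat-weight u c + sat-weight v d)
          ≡⟨ cong (λ k → saturation φ + (k + sat-weight v d))
               (sat-weight-high (≤-<-trans (m≤m⊔n (t u) (t v)) (≰⇒> c≰))) ⟩
        saturation φ + sat-weight v d  ≤⟨ +-monoʳ-≤ (saturation φ) (sat-weight≤1 v d) ⟩
        saturation φ + 1  ∎))
        where open ≤-Reasoning

      module Move {w φ′} (s : Slide φ v u w c φ′) (q≢v : q ≢ v) where
        open Slide s using (valid′; colour-z; colour-z′; colour-y′; edge-z; elsewhere)
        open SlideProperties s

        wv-colour : φ w v ≡ c
        wv-colour = trans (symmetric valid w v) colour-z

        zx-colour′ : φ′ z x ≡ β
        zx-colour′ = trans (elsewhere (off z∈S x∈S) (off z∈S x∈S)) zx-colour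
          where
          off : ∀ {a b k} → a ∈ S → b ∈ S → ¬ Same v k a b
          off a∈ b∈ (inj₁ (refl , _)) = v∉S a∈
          off a∈ b∈ (inj₂ (_ , refl)) = v∉S b∈

        v-missing′ : Missing φ′ v d
        v-missing′ = keep-missing d≢0 (λ where refl → contradiction u∈S v∉S) v-missing

        q-missing′ : Missing φ′ q β
        q-missing′ = keep-missing β≢0 (λ where refl → contradiction u∈S q∉S) q-missing

        -- After the slide the only `α`/`β`-edge at `v` is `vu`: `v` misses `d`, and its edge of
        -- colour `c` is now `vu` instead of `vw`.
        closed′ : ∀ {a b} → a ∈ v ∷ S → a ≢ z → φ′ a b ≡ α ⊎ φ′ a b ≡ β → b ∈ v ∷ S
        closed′ {a} {b} a∈ a≢z col = from-trace a∈ (trace nonzero)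
          where
          nonzero : φ′ a b ≢ 0
          nonzero = [ (λ eq → α≢0 ∘ trans (≡-sym eq)) , (λ eq → β≢0 ∘ trans (≡-sym eq)) ]′ col
          cd : ∀ {k} → k ≡ α ⊎ k ≡ β → k ≡ c ⊎ k ≡ d
          cd k∈ with colours | k∈
          ... | inj₁ (refl , refl) | k = k
          ... | inj₂ (refl , refl) | inj₁ k = inj₂ k
          ... | inj₂ (refl , refl) | inj₂ k = inj₁ k
          from-trace : a ∈ v ∷ S → φ′ a b ≡ φ a b ⊎ (Same v u a b × φ′ a b ≡ c) → b ∈ v ∷ S
          from-trace _ (inj₂ (inj₁ (_ , refl) , _)) = there u∈S
          from-trace _ (inj₂ (inj₂ (_ , refl) , _)) = here refl
          from-trace (there a∈S) (inj₁ old) =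
            there (closed a∈S a≢z (subst (λ k → k ≡ α ⊎ k ≡ β) old col))
          from-trace (here refl) (inj₁ old) with cd (subst (λ k → k ≡ α ⊎ k ≡ β) old col)
          ... | inj₂ is-d = contradiction is-d (v-missing b)
          ... | inj₁ is-c with injective valid (c≢0 ∘ trans (≡-sym is-c)) (trans is-c (≡-sym colour-z))
          ... | refl = contradiction colour-z′ nonzero

        advance : w ≢ z → w ∉ S → State φ′ v w d c (v ∷ S)
        advance w≢z w∉S = record
          { valid      = valid′
          ; edge       = edge-z
          ; uncoloured = colour-z′
          ; u-missing  = v-missing′
          ; v-missing  = freed-missing
          ; colours    = [ (λ (p , r) → inj₂ (r , p)) , (λ (p , r) → inj₁ (r , p)) ]′ colours
          ; same-size  = trans same-size (slide-size s)
          ; potential  = subst (saturation φ₀ + 2 ≤_) conserved potential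
          ; agrees     = Agrees-slide agrees s c∈
          ; unique     = ∷-Unique v∉S unique
          ; u∈S        = here refl
          ; v∉S        = λ where
              (here refl) → Edge⇒≢ edge-z refl
              (there w∈S) → w∉S w∈S
          ; x∈S        = there x∈S
          ; z∈S        = there z∈S
          ; closed     = closed′
          ; zx-colour  = zx-colour′
          ; q-missing  = q-missing′
          ; q∉S        = λ where
              (here q≡v) → q≢v q≡v
              (there q∈S) → q∉S q∈S
          -- An edge of colour `β` cannot lead to `q`, so `q` is entered along `α` and the next
          -- colour is `β`, which `q` misses: the walk never passes through `q`.
          ; q-arrival  = λ where
              refl → [ proj₂ , (λ p → contradiction (trans wv-colour (proj₁ p)) (q-missing v)) ]′ colours
          }
          where
          -- `u` gains `c` and `w` loses it, while `w` replaces `u` as the end that misses `c`.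
          conserved : saturation φ + (sat-weight u c + sat-weight v d) ≡
                      saturation φ′ + (sat-weight v d + sat-weight w c)
          conserved = begin
            saturation φ + (sat-weight u c + sat-weight v d)  ≡⟨ +-assoc (saturation φ) _ _ ⟨
            saturation φ + sat-weight u c + sat-weight v d
              ≡⟨ cong (_+ sat-weight v d) (slide-saturation s) ⟨
            saturation φ′ + sat-weight w c + sat-weight v d  ≡⟨ +-assoc (saturation φ′) _ _ ⟩
            saturation φ′ + (sat-weight w c + sat-weight v d)
              ≡⟨ cong (saturation φ′ +_) (+-comm (sat-weight w c) _) ⟩
            saturation φ′ + (sat-weight v d + sat-weight w c)  ∎
            where open ≡-Reasoning

        close-up : w ≡ z → ∃ Flipped
        close-up refl with colours
        -- The only `β`-edge at `z` goes to `x`, which was passed already, whereas `v` was not.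
        ... | inj₂ (refl , _) =
          contradiction (subst (_∈ S) (≡-sym v≡x) x∈S) v∉S
          where
          v≡x : v ≡ x
          v≡x = injective valid (c≢0 ∘ trans (≡-sym wv-colour)) (trans wv-colour (≡-sym zx-colour))
        -- One last slide moves `β` from `zx` to `zv`, so that `xz` is uncoloured again and `x`
        -- misses `β`.
        ... | inj₁ (refl , refl)
          with slide valid′ (Edge-sym edge-z) (trans (symmetric valid′ z v) colour-z′) zx-colour′ β≢0
                 v-missing′ (≤-trans β≤tz (m≤m⊔n (t z) (t v)))
        ... | φ″ , s′ = φ″ , record
          { valid      = Slide.valid′ s′
          ; uncoloured = trans (symmetric (Slide.valid′ s′) x z) (Slide.colour-z′ s′)
          ; same-size  = trans same-size (trans (slide-size s) (slide-size s′))
          ; x-missing  = SlideProperties.freed-missing s′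
          ; q-missing  = SlideProperties.keep-missing s′ β≢0 (λ q≡v → contradiction q≡v q≢v) q-missing′
          ; agrees     = Agrees-slide (Agrees-slide agrees s (inj₁ refl)) s′ (inj₂ refl)
          }

      step : Improvable φ₀ ⊎ ∃ Flipped
      step with c ≤? t u ⊔ t v
      ... | no c≰ = inj₁ (blocked c≰)
      ... | yes c≤ with neighbour? φ v c
      ... | inj₂ v∌c = inj₁ (paint-improves same-size valid edge uncoloured c≢0 u-missing v∌c c≤)
      ... | inj₁ (w , vw) with slide valid (Edge-sym edge) (trans (symmetric valid v u) uncoloured) vw c≢0
                                 u-missing (subst (c ≤_) (⊔-comm (t u) (t v)) c≤)
      ... | φ′ , s with w ≟F z | w ∈? S
      ... | yes w≡z | _ = inj₂ (Move.close-up s q≢v w≡z)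
        where
        q≢v : q ≢ v
        q≢v refl = q-missing w (trans vw (q-arrival refl))
      ... | no w≢z | yes w∈S = contradiction
        (closed w∈S w≢z (either c∈ (trans (symmetric valid w v) vw))) v∉S
      ... | no w≢z | no w∉S = walk fuel (subst (n <_) (≡-sym (+-suc fuel (length S))) n<)
        (Move.advance s q≢v w≢z w∉S)
        where
        q≢v : q ≢ v
        q≢v refl = q-missing w (trans vw (q-arrival refl))

  -- The first slide moves `β` from `xp` to `xz`. The initial surplus of 2 in the potential comes
  -- from `α` at `x` and `β` at `z`, both within the bounds of these vertices.
  kempe : ∀ {φ₀ φ x z p q α β} → φ₀ ⊑ φ → Valid φ → Edge x z → φ x z ≡ 0 →
    MissingBelow φ x α → MissingBelow φ z β → φ x p ≡ β → Missing φ q β → q ≢ z →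
    ∀ α≢0 β≢0 β≤tz → Improvable φ₀ ⊎ ∃ (Kempe.Flipped φ₀ φ x z q α β α≢0 β≢0 β≤tz)
  kempe {φ₀} {φ} {x} {z} {p} {q} {α} {β} (sz , sat≤) val e unc (x∌α , _ , α≤tx) (z∌β , _ , _)
        xp q∌β q≢z α≢0 β≢0 β≤tz
    with slide val e unc xp β≢0 z∌β (≤-trans β≤tz (m≤n⊔m (t x) (t z)))
  ... | φ₁ , s = walk n {S = x ∷ z ∷ []} (m<m+n n (s≤s z≤n)) record
    { valid      = valid′
    ; edge       = edge-z
    ; uncoloured = colour-z′
    ; u-missing  = x∌α′
    ; v-missing  = freed-missing
    ; colours    = inj₁ (refl , refl)
    ; same-size  = trans sz (slide-size s)
    ; potential  = pot
    ; agrees     = Agrees-slide Agrees-refl s (inj₂ refl)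
    ; unique     = ∷-Unique (λ where (here x≡z) → Edge⇒≢ e x≡z) (∷-Unique (λ ()) [])
    ; u∈S        = here refl
    ; v∉S        = λ where
        (here p≡x)         → Edge⇒≢ edge-z (≡-sym p≡x)
        (there (here p≡z)) → y≢z (≡-sym p≡z)
    ; x∈S        = here refl
    ; z∈S        = there (here refl)
    ; closed     = clo
    ; zx-colour  = trans (symmetric valid′ z x) colour-y′
    ; q-missing  = keep-missing β≢0 (λ q≡z → contradiction q≡z q≢z) q∌β
    ; q∉S        = λ where
        (here refl)        → q∌β p xp
        (there (here q≡z)) → q≢z q≡z
    ; q-arrival  = λ where refl → contradiction (trans (symmetric val p x) xp) (q∌β x)
    }
    where
    open Kempe φ₀ φ x z q α β α≢0 β≢0 β≤tz
    open Slide s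
    open SlideProperties s
    x∌α′ : Missing φ₁ x α
    x∌α′ = keep-missing α≢0 (λ where refl → contradiction refl (Edge⇒≢ e)) x∌α
    clo : ∀ {w v} → w ∈ x ∷ z ∷ [] → w ≢ z → φ₁ w v ≡ α ⊎ φ₁ w v ≡ β → v ∈ x ∷ z ∷ []
    clo (there (here w≡z)) w≢z _ = contradiction w≡z w≢z
    clo (here refl) _ (inj₁ eq) = contradiction eq (x∌α′ _)
    clo (here refl) _ (inj₂ eq) with injective valid′ (β≢0 ∘ trans (≡-sym eq)) (trans eq (≡-sym colour-y′))
    ... | refl = there (here refl)
    pot : saturation φ₀ + 2 ≤ saturation φ₁ + (sat-weight x α + sat-weight p β)
    pot = begin
      saturation φ₀ + 2  ≤⟨ +-monoˡ-≤ 2 sat≤ ⟩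
      saturation φ + 2  ≡⟨ +-assoc (saturation φ) 1 1 ⟨
      saturation φ + 1 + 1  ≡⟨ cong (λ k → saturation φ + k + 1) (sat-weight-low β≢0 β≤tz) ⟨
      saturation φ + sat-weight z β + 1  ≡⟨ cong (_+ 1) (slide-saturation s) ⟨
      saturation φ₁ + sat-weight p β + 1  ≡⟨ +-assoc (saturation φ₁) _ 1 ⟩
      saturation φ₁ + (sat-weight p β + 1)  ≡⟨ cong (saturation φ₁ +_) (+-comm _ 1) ⟩
      saturation φ₁ + (1 + sat-weight p β)
        ≡⟨ cong (λ k → saturation φ₁ + (k + sat-weight p β)) (sat-weight-low α≢0 α≤tx) ⟨
      saturation φ₁ + (sat-weight x α + sat-weight p β)  ∎
      where open ≤-Reasoning

  -- Growing a fan until it improves or meets a full vertex.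

  Full : V → Set
  Full v = t v ≤ deg G v

  -- At a full vertex whose edges are all coloured no missing colour within the bound is guaranteed,
  -- so a fan stops there. The field `z≢y` keeps the resulting walk from turning back.
  record FullNeighbour (φ₀ : Colouring) (x y : V) : Set where
    field
      {z}        : V
      {φ}        : Colouring
      edge       : Edge x z
      z≢y        : z ≢ y
      full       : Full z
      valid      : Valid φ
      uncoloured : φ x z ≡ 0
      above      : φ₀ ⊑ φ

  ⊑-trans : ∀ {φ φ′ φ″} → φ ⊑ φ′ → φ′ ⊑ φ″ → φ ⊑ φ″
  ⊑-trans (p , q) (p′ , q′) = trans p p′ , ≤-trans q q′

  -- The fan vertex just before `w` misses `β` too, and `head` ensures that it is not `y`. After the
  -- swap `x` also misses `β`, so sliding along the fan up to that vertex frees an edge for `β`.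
  fan-repeats : ∀ {φ₀ φ x y L y₀ w β} → φ₀ ⊑ φ → Valid φ → Edge x y → φ x y ≡ 0 →
    Fan φ x y L y₀ → MissingBelow φ y β → (∀ {p L′} → L ≡ p ∷ L′ → β ≢ φ x p) →
    φ x w ≡ β → w ∈ L → Improvable φ₀
  fan-repeats {φ₀} {φ} {x} {y} {L} {y₀} {w} {β} above val e unc fan y∌β@(_ , β≢0 , β≤) head xw w∈
    with missing-at-uncoloured val e unc | Cut.end-pos (cut fan w∈)
  ... | _ | inj₁ (_ , L≡) = contradiction (≡-sym xw) (head L≡)
  ... | α , x∌α@(x-misses , α≢0 , _) | inj₂ end∈ =
    [ (λ improvable → improvable) , (λ (_ , F) → finish F) ]′
      (kempe above val e unc x∌α y∌β xw (subst (Missing φ C.end) xw C.missing)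
        (λ end≡y → Fan-coloured C.fan end∈ (trans (cong (φ x) end≡y) unc)) α≢0 β≢0 β≤)
    where
    module C = Cut (cut fan w∈)
    finish : ∀ {φ′} → Kempe.Flipped φ₀ φ x y C.end α β α≢0 β≢0 β≤ φ′ → Improvable φ₀
    finish F = Fan-improves F.same-size F.valid e F.uncoloured
      -- No edge from `x` to the prefix has colour `α`, which `x` misses, or `β`, which `x` has only
      -- on `xw`.
      (Fan-transport
        (λ l∈ → F.agrees.colours (Fan-coloured C.fan l∈) (x-misses _) (≢β l∈))
        (λ _ l∈ → F.agrees.missing (Fan-coloured C.fan l∈) (x-misses _) (≢β l∈))
        C.fan)
      F.x-missing F.q-missing β≢0 (subst (_≤ t x ⊔ t C.end) xw C.allowed)
      where
      module F where
        open Kempe.Flipped F public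
        module agrees = Kempe.Agrees agrees
      ≢β : ∀ {l} → l ∈ C.prefix → φ x l ≢ β
      ≢β l∈ eq with injective val (Fan-coloured C.fan l∈) (trans eq (≡-sym xw))
      ... | refl = C.p∉prefix l∈

  -- Each round slides `β` from `xw` to `xy` and puts `y` in front of the duplicate-free list `L`,
  -- which bounds the number of rounds. The hypothesis on the head of `L` prevents the previous
  -- slide from being undone.
  grow-fan : ∀ fuel {φ₀ φ x y L y₀ β} → n < fuel + length L → φ₀ ⊑ φ → Valid φ → Edge x y →
    φ x y ≡ 0 → Fan φ x y L y₀ → Unique L → y₀ ∈ y ∷ L → MissingBelow φ y β →
    (∀ {p L′} → L ≡ p ∷ L′ → β ≢ φ x p) → Improvable φ₀ ⊎ FullNeighbour φ₀ x y₀
  grow-fan zero n< _ _ _ _ _ uniq _ _ _ = contradiction (Unique-length uniq) (<⇒≱ n<)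
  grow-fan (suc fuel) {φ₀} {φ} {x} {y} {L} {y₀} {β} n< above val e unc fan uniq y₀∈
    y-β@(y∌β , β≢0 , β≤) head
    with neighbour? φ x β
  ... | inj₂ x∌β =
    inj₁ (paint-improves (proj₁ above) val e unc β≢0 x∌β y∌β (≤-trans β≤ (m≤n⊔m (t x) (t y))))
  ... | inj₁ (w , xw) with w ∈? L
  ... | yes w∈ = inj₁ (fan-repeats above val e unc fan y-β head xw w∈)
  ... | no w∉ with slide val e unc xw β≢0 y∌β (≤-trans β≤ (m≤n⊔m (t x) (t y)))
  ... | φ′ , s with t w ≤? deg G w
  ... | yes full = inj₂ record
    { edge       = edge-z
    ; z≢y        = w≢y₀ y₀∈
    ; full       = full
    ; valid      = valid′
    ; uncoloured = colour-z′
    ; above      = ⊑-trans above (slide-⊑ s β≤)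
    }
    where
    open Slide s
    open SlideProperties s
    w≢y₀ : y₀ ∈ y ∷ L → w ≢ y₀
    w≢y₀ (here refl) = ≢-sym y≢z
    w≢y₀ (there y₀∈) refl = w∉ y₀∈
  -- `γ` is chosen before the slide, when `w` still has `β`; therefore `γ` differs from `β`, the
  -- colour at the head of the new fan.
  ... | no ¬full with missing-at-deficient val (≰⇒> ¬full)
  ... | γ , w∌γ , γ≢0 , γ≤ =
    grow-fan fuel (subst (n <_) (≡-sym (+-suc fuel (length L))) n<)
      (⊑-trans above (slide-⊑ s β≤)) valid′ edge-z colour-z′ fan′
      (∷-Unique (λ y∈ → Fan-coloured fan y∈ unc) uniq) (there y₀∈)
      (keep-missing γ≢0 (λ w≡y → contradiction (≡-sym w≡y) y≢z) w∌γ , γ≢0 , γ≤)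
      λ where refl γ≡ → w∌γ x (trans (symmetric val w x) (trans xw (≡-sym (trans γ≡ colour-y′))))
    where
    open Slide s
    open SlideProperties s
    fan′ : Fan φ′ x w (y ∷ L) y₀
    fan′ = ( subst (Missing φ′ w) (≡-sym colour-y′) freed-missing
           , (λ eq → β≢0 (trans (≡-sym colour-y′) eq))
           , subst (_≤ t x ⊔ t w) (trans xw (≡-sym colour-y′)) (bounded val x w)
           , (λ y∈ → Fan-coloured fan y∈ unc))
      ∷ Fan-transport
          (λ l∈ → at-centre (λ where refl → Fan-coloured fan l∈ unc) (λ where refl → w∉ l∈))
          (λ _ l∈ → keep-missing (Fan-coloured fan l∈) (λ _ → ≢β l∈))
          fan
      where
      ≢β : ∀ {l} → l ∈ L → φ x l ≢ β
      ≢β l∈ eq with injective val (Fan-coloured fan l∈) (trans eq (≡-sym xw))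
      ... | refl = w∉ l∈

  -- The first vertex `y` may be full: it has a missing colour within the bound because `xy` is
  -- uncoloured.
  improve-or-move : ∀ {φ₀ φ x y} → φ₀ ⊑ φ → Valid φ → Edge x y → φ x y ≡ 0 →
    Improvable φ₀ ⊎ FullNeighbour φ₀ x y
  improve-or-move {y = y} above val e unc
    with missing-at-uncoloured val (Edge-sym e) (trans (symmetric val y _) unc)
  ... | β , y∌β = grow-fan (suc n) (s≤s (m≤m+n n 0)) above val e unc [] [] (here refl) y∌β λ ()

  -- Paths of full vertices, newest vertex first.

  data Trail : V → List V → V → Set where
    [_] : ∀ {v} → Full v → Trail v [] v
    _∷_ : ∀ {v u L z} → Full v × Edge v u × v ∉ u ∷ L → Trail u L z → Trail v (u ∷ L) z

  Trail-unique : ∀ {v L z} → Trail v L z → Unique (v ∷ L)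
  Trail-unique [ _ ] = ∷-Unique (λ ()) []
  Trail-unique ((_ , _ , v∉) ∷ tr) = ∷-Unique v∉ (Trail-unique tr)

  Trail-full : ∀ {v L z} → Trail v L z → ∀ i → Full (lookup (v ∷ L) i)
  Trail-full [ f ]          zero    = f
  Trail-full ((f , _) ∷ _)  zero    = f
  Trail-full (_ ∷ tr)       (suc i) = Trail-full tr i

  Trail-edge : ∀ {v L z} → Trail v L z → ∀ (i : Fin (length L)) →
    Edge (lookup (v ∷ L) (inject₁ i)) (lookup L i)
  Trail-edge ((_ , e , _) ∷ _) zero    = e
  Trail-edge (_ ∷ tr)          (suc i) = Trail-edge tr i

  Trail-last : ∀ {v L z} → Trail v L z → lookup (v ∷ L) (fromℕ (length L)) ≡ z
  Trail-last [ _ ]    = refl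
  Trail-last (_ ∷ tr) = Trail-last tr

  Trail-cut : ∀ {v L y z} → Trail v L y → z ∈ v ∷ L →
    ∃ λ L′ → Trail v L′ z × (∀ {l} → l ∈ v ∷ L′ → l ∈ v ∷ L)
  Trail-cut tr (here refl) = [] , [ Trail-full tr zero ] , λ where (here eq) → here eq
  Trail-cut ((f , e , v∉) ∷ tr) (there z∈) with Trail-cut tr z∈
  ... | L′ , tr′ , sub = _ , (f , e , v∉ ∘ sub) ∷ tr′ , λ where
    (here eq)  → here eq
    (there l∈) → there (sub l∈)

  -- As `z` lies beyond the second vertex `a`, the piece of the path from `v` to `z` has at least
  -- three vertices, enough for a cycle.
  Trail-close : ∀ {v a L y z} → Trail v (a ∷ L) y → z ∈ L → Edge z v → CycleIn G Full
  Trail-close ((f , e , v∉) ∷ ((f′ , e′ , a∉) ∷ tr)) z∈ zv with Trail-cut tr z∈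
  ... | L′ , tr′ , sub = record
    { j     = length L′
    ; f     = lookup (_ ∷ _ ∷ _ ∷ L′)
    ; inj   = lookup-injective (Trail-unique cyc)
    ; step  = Trail-edge cyc
    ; close = subst (λ w → Edge w _) (≡-sym (Trail-last cyc)) zv
    ; inP   = Trail-full cyc
    }
    where
    cyc = (f , e , λ where
            (here eq)  → v∉ (here eq)
            (there l∈) → v∉ (there (sub l∈)))
      ∷ ((f′ , e′ , a∉ ∘ sub) ∷ tr′)

  -- Improving until every edge is coloured.

  module Acyclic (acyclic : ¬ CycleIn G Full) where

    -- The fan is restarted at the newest full vertex `v`, with the edge back to `u` uncoloured. The
    -- next full vertex is neither `v` nor `u`, so meeting the trail again would close a cycle;
    -- otherwise the trail grows, at most to `n` vertices.
    follow : ∀ fuel {φ₀ φ v u L y} → n ≤ fuel + length L → φ₀ ⊑ φ → Valid φ → Edge v u →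
      φ v u ≡ 0 → Trail v L y → (∀ {a L′} → L ≡ a ∷ L′ → a ≡ u) → Improvable φ₀
    follow zero n≤ _ _ _ _ tr _ = contradiction (Unique-length (Trail-unique tr)) (<⇒≱ (s≤s n≤))
    follow (suc fuel) {v = v} {u} {L} n≤ above val e unc tr back with improve-or-move above val e unc
    ... | inj₁ improvable = improvable
    ... | inj₂ N with N.z ∈? v ∷ L
      where module N = FullNeighbour N
    ... | no z∉ = follow fuel (subst (n ≤_) (≡-sym (+-suc fuel (length L))) n≤) N.above N.valid
        (Edge-sym N.edge) (trans (symmetric N.valid N.z v) N.uncoloured)
        ((N.full , Edge-sym N.edge , z∉) ∷ tr) λ where refl → refl
      where module N = FullNeighbour N
    ... | yes (here z≡v) = contradiction (≡-sym z≡v) (Edge⇒≢ N.edge)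
      where module N = FullNeighbour N
    ... | yes (there z∈) = revisit tr z∈ back
      where
      module N = FullNeighbour N
      revisit : ∀ {L y} → Trail v L y → N.z ∈ L → (∀ {a L′} → L ≡ a ∷ L′ → a ≡ u) → Improvable _
      revisit tr (here refl) back = contradiction (back refl) N.z≢y
      revisit tr (there z∈)  back = contradiction (Trail-close tr z∈ (Edge-sym N.edge)) acyclic

    improve : ∀ {φ x y} → Valid φ → Edge x y → φ x y ≡ 0 → Improvable φ
    improve {x = x} val e unc with improve-or-move (refl , ≤-refl) val e unc
    ... | inj₁ improvable = improvable
    -- The trail starts at the full neighbour, since `x` itself need not be full.
    ... | inj₂ N = follow n (m≤m+n n 0) N.above N.valid (Edge-sym N.edge)
        (trans (symmetric N.valid N.z x) N.uncoloured) [ N.full ] λ ()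
      where module N = FullNeighbour N

    Complete : Colouring → Set
    Complete φ = ∀ u v → Edge u v → φ u v ≢ 0

    bound : ℕ
    bound = n * (n * 1)

    size≤ : ∀ φ → size φ ≤ bound
    size≤ = total≤ size-weight size-weight≤1

    saturation≤ : ∀ φ → saturation φ ≤ bound
    saturation≤ = total≤ sat-weight sat-weight≤1

    Completion : Set
    Completion = ∃ λ φ → Valid φ × Complete φ

    uncoloured? : ∀ (φ : Colouring) → Dec (∃ λ u → ∃ λ v → Edge u v × φ u v ≡ 0)
    uncoloured? φ = any? λ u → any? λ v → (adj G u v Bool.≟ true) ×-dec (φ u v ≟ℕ 0)

    -- Lexicographic recursion: `a` and `b` bound the remaining growth of size and saturation. When
    -- the size grows, `b` is reset to `bound`, as the saturation may drop.
    complete : ∀ a b {φ} → Valid φ → bound ≤ a + size φ → bound ≤ b + saturation φ → Completion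
    complete-larger : ∀ a {φ φ′} → Valid φ′ → bound ≤ a + size φ → size φ < size φ′ → Completion
    complete-fuller : ∀ a b {φ φ′} → Valid φ′ → bound ≤ a + size φ′ → bound ≤ b + saturation φ →
      saturation φ < saturation φ′ → Completion

    complete a b {φ} val a≥ b≥ with uncoloured? φ
    ... | no none = φ , val , λ _ _ e unc → none (_ , _ , e , unc)
    ... | yes (_ , _ , e , unc) with improve val e unc
    ... | φ′ , val′ , inj₁ larger = complete-larger a val′ a≥ larger
    ... | φ′ , val′ , inj₂ (same , fuller) =
      complete-fuller a b {φ} {φ′} val′ (subst (λ k → bound ≤ a + k) same a≥) b≥ fuller

    complete-larger zero {φ′ = φ′} _ a≥ larger = contradiction (size≤ φ′) (<⇒≱ (≤-<-trans a≥ larger))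
    complete-larger (suc a) {φ} val′ a≥ larger = complete a bound val′
      (≤-trans (subst (bound ≤_) (≡-sym (+-suc a (size φ))) a≥) (+-monoʳ-≤ a larger)) (m≤m+n bound _)

    complete-fuller a zero {φ′ = φ′} _ _ b≥ fuller =
      contradiction (saturation≤ φ′) (<⇒≱ (≤-<-trans b≥ fuller))
    complete-fuller a (suc b) {φ} val′ a≥ b≥ fuller = complete a b val′ a≥
      (≤-trans (subst (bound ≤_) (≡-sym (+-suc b (saturation φ))) b≥) (+-monoʳ-≤ b fuller))

    empty-valid : Valid (λ _ _ → 0)
    empty-valid = record
      { symmetric = λ _ _ → refl
      ; support   = λ nz → contradiction refl nz
      ; injective = λ nz → contradiction refl nz
      ; bounded   = λ _ _ → z≤n
      }

    completion : Completion
    completion = complete bound bound {λ _ _ → 0} empty-valid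
      (m≤m+n bound (size λ _ _ → 0)) (m≤m+n bound (saturation λ _ _ → 0))

-- From bounded colourings to proper local ones.

mult-positive : ∀ {n} (G : SimpleGraph n) {v} → 0 < deg G v → mult G v ≡ 1
mult-positive G {v} d>0 with deg G v
... | suc _ = refl

theorem1p2 : ∀ (n : ℕ) (G : SimpleGraph n) (k : ℕ) → 1 ≤ k →
    (∀ v → deg G v ≤ k) → MaxDegreeForest G k → ProperLocalColouring G k
theorem1p2 n G k 1≤k deg≤k forest = record
  { φ      = φ
  ; symm   = λ x y _ → symmetric x y
  ; range  = λ x y e → n≢0⇒n>0 (complete x y e) ,
      ≤-trans (bounded x y) (⊔-lub (m⊓n≤m k _) (m⊓n≤m k _))
  ; proper = λ x y z xy _ y≢z eq → y≢z (injective (complete x y xy) eq)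
  ; local  = λ x y e → ≤-trans (bounded x y) (⊔-mono-≤ (t≤ e) (t≤ (Edge-sym e)))
  }
  where
  t : Fin n → ℕ
  t v = k ⊓ suc (deg G v)

  deg≤t : ∀ v → deg G v ≤ t v
  deg≤t v = ⊓-glb (deg≤k v) (n≤1+n _)

  open Extension G t deg≤t

  -- If the minimum `t v` were `suc (deg G v)`, it would exceed the degree, so it is `k`.
  full⇒maximal : ∀ v → Full v → deg G v ≡ k
  full⇒maximal v full with ⊓-sel k (suc (deg G v))
  ... | inj₁ t≡k = ≤-antisym (deg≤k v) (subst (_≤ deg G v) t≡k full)
  ... | inj₂ t≡1+d = contradiction (subst (_≤ deg G v) t≡1+d full) 1+n≰n

  acyclic : ¬ CycleIn G Full
  acyclic C = forest record
    { j = C.j ; f = C.f ; inj = C.inj ; step = C.step ; close = C.close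
    ; inP = λ i → full⇒maximal _ (C.inP i) }
    where module C = CycleIn C

  open Acyclic acyclic using (completion)
  φ = proj₁ completion
  open Valid (proj₁ (proj₂ completion))
  complete = proj₂ (proj₂ completion)

  t≤ : ∀ {x y} → Edge x y → t x ≤ deg G x + mult G x
  t≤ {x} {y} e = begin
    k ⊓ suc (deg G x)  ≤⟨ m⊓n≤n k _ ⟩
    suc (deg G x)  ≡⟨ +-comm 1 (deg G x) ⟩
    deg G x + 1  ≡⟨ cong (deg G x +_) (mult-positive G deg>0) ⟨
    deg G x + mult G x  ∎
    where
    open ≤-Reasoning
    deg>0 : 0 < deg G x
    deg>0 = injection≤deg G x (λ _ → y) (λ { {zero} {zero} _ → refl }) (λ _ → e)
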